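{- Let $q$ be a prime power, $n\ge 1$ an integer, and $H(x)\in\mathbb{F}_{q^n}[x]$ such that the map $x\mapsto\mathrm{Tr}(H(x))$ is not constant on $\mathbb{F}_{q^n}$. Let $P_H=\{\gamma\in\mathbb{F}_{q^n} : x+\gamma\,\mathrm{Tr}(H(x)) \text{ is a permutation polynomial over } \mathbb{F}_{q^n}\}$. Let $\alpha\in\mathbb{F}_{q^n}$ be nonzero. Then $\alpha\mathbb{F}_q\subset P_H$ if and only if $\alpha$ is a $0$-linear translator of the function $\mathrm{Tr}(H(x))$.
   Context: $\mathrm{Tr}:\mathbb{F}_{q^n}\to\mathbb{F}_q$ is the trace map $\mathrm{Tr}(x)=x+x^q+\cdots+x^{q^{n-1}}$. A polynomial $f$ over $\mathbb{F}_{q^n}$ is a permutation polynomial if the map $x\mapsto f(x)$ is a bijection of $\mathbb{F}_{q^n}$ onto itself. For a function $f:\mathbb{F}_{q^n}\to\mathbb{F}_q$, $a\in\mathbb{F}_q$ and a nonzero $\alpha\in\mathbb{F}_{q^n}$, $\alpha$ is called an $a$-linear translator of $f$ if $f(x+u\alpha)-f(x)=ua$ for all $x\in\mathbb{F}_{q^n}$ and all $u\in\mathbb{F}_q$. Here $\alpha\mathbb{F}_q=\{\alpha u:u\in\mathbb{F}_q\}$, and $\subset$ denotes (not necessarily strict) inclusion. -}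

module Defs where

open import Level using (Level; _⊔_) renaming (suc to lsuc)
open import Algebra.Apartness.Bundles using (HeytingField; HeytingCommutativeRing)
open import Algebra.Bundles using (CommutativeRing; Semiring)
open import Algebra.Bundles.Raw using (RawSemiring)
open import Algebra.Morphism.Structures using (module RingMorphisms)
import Algebra.Definitions.RawSemiring as RawSemiringOps
open import Data.Fin.Base using (Fin; toℕ)
open import Data.List.Base using (List; []; _∷_; map)
open import Data.Nat.Base as ℕ using (ℕ; zero; suc)
open import Data.Nat.Primality using (Prime)
open import Data.Product.Base using (∃; ∃₂; _×_)
open import Function.Bundles using (Inverse)
open import Function.Definitions using (Bijective)
open import Relation.Binary.Bundles using (Setoid)
open import Relation.Binary.PropositionalEquality using (_≡_; setoid)
open import Relation.Nullary.Negation using (¬_)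
open import Relation.Unary using (Pred)

IsPrimePower : ℕ → Set
IsPrimePower q = ∃₂ λ p k → Prime p × 1 ℕ.≤ k × q ≡ p ℕ.^ k

HasOrder : ∀ {c ℓ} → Setoid c ℓ → ℕ → Set (c ⊔ ℓ)
HasOrder S m = Inverse S (setoid (Fin m))

fieldRing : ∀ {c ℓ₁ ℓ₂} → HeytingField c ℓ₁ ℓ₂ → CommutativeRing c ℓ₁
fieldRing F = HeytingCommutativeRing.commutativeRing (HeytingField.heytingCommutativeRing F)

-- 𝔽_q ⊂ 𝔽_{q^n}: the inclusion is a ring homomorphism ι, automatically
-- injective.  An order yields decidable equality, and then the apartness
-- _#_ of a Heyting field is the negation of _≈_, so that these are finite
-- fields in the usual sense.
record FiniteFieldExtension (q n : ℕ) (a ℓ₁ ℓ₂ b ℓ₃ ℓ₄ : Level) :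
       Set (lsuc (a ⊔ ℓ₁ ⊔ ℓ₂ ⊔ b ⊔ ℓ₃ ⊔ ℓ₄)) where
  field
    baseField : HeytingField a ℓ₁ ℓ₂
    topField  : HeytingField b ℓ₃ ℓ₄

  module F = CommutativeRing (fieldRing baseField)
  module K = CommutativeRing (fieldRing topField)

  field
    F-order : HasOrder F.setoid q
    K-order : HasOrder K.setoid (q ℕ.^ n)
    ι       : F.Carrier → K.Carrier
    ι-hom   : RingMorphisms.IsRingHomomorphism F.rawRing K.rawRing ι

-- x + x^q + ⋯ + x^(q^(n-1)), over any semiring, so that it can be applied
-- both to field elements and to polynomials.
traceSum : ∀ {c ℓ} (R : RawSemiring c ℓ) (q n : ℕ) →
           RawSemiring.Carrier R → RawSemiring.Carrier R
traceSum R q n x = sum {n} (λ i → x ^ (q ℕ.^ toℕ i))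
  where open RawSemiringOps R using (sum; _^_)

module Polynomials {c ℓ} (R : CommutativeRing c ℓ) where
  open CommutativeRing R

  -- Coefficients in order of increasing degree; trailing zeros are allowed
  -- and ignored by _≈ₚ_.
  Poly : Set c
  Poly = List Carrier

  coeff : Poly → ℕ → Carrier
  coeff []      _       = 0#
  coeff (a ∷ _) zero    = a
  coeff (_ ∷ f) (suc i) = coeff f i

  infix  4 _≈ₚ_
  infixl 6 _+ₚ_
  infixl 7 _*ₚ_ _·ₚ_

  _≈ₚ_ : Poly → Poly → Set ℓ
  f ≈ₚ g = ∀ i → coeff f i ≈ coeff g i

  _+ₚ_ : Poly → Poly → Poly
  []      +ₚ g       = g
  (a ∷ f) +ₚ []      = a ∷ f
  (a ∷ f) +ₚ (b ∷ g) = (a + b) ∷ (f +ₚ g)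

  _·ₚ_ : Carrier → Poly → Poly
  a ·ₚ f = map (a *_) f

  _*ₚ_ : Poly → Poly → Poly
  []      *ₚ g = []
  (a ∷ f) *ₚ g = a ·ₚ g +ₚ (0# ∷ f *ₚ g)

  X : Poly
  X = 0# ∷ 1# ∷ []

  polySemiring : RawSemiring c ℓ
  polySemiring = record
    { Carrier = Poly
    ; _≈_     = _≈ₚ_
    ; _+_     = _+ₚ_
    ; _*_     = _*ₚ_
    ; 0#      = []
    ; 1#      = 1# ∷ []
    }

  eval : Poly → Carrier → Carrier
  eval []      x = 0#
  eval (a ∷ f) x = a + x * eval f x

  IsPermutationPolynomial : Poly → Set (c ⊔ ℓ)
  IsPermutationPolynomial f = Bijective _≈_ _≈_ (eval f)

module Extension {q n a ℓ₁ ℓ₂ b ℓ₃ ℓ₄}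
                 (E : FiniteFieldExtension q n a ℓ₁ ℓ₂ b ℓ₃ ℓ₄) where
  open FiniteFieldExtension E public
  open Polynomials (fieldRing topField) public

  private
    rawK : RawSemiring b ℓ₃
    rawK = Semiring.rawSemiring K.semiring

  -- The trace takes its values in the image of ι; here and in
  -- IsLinearTranslator, functions into 𝔽_q are regarded as functions into
  -- 𝔽_{q^n}.
  Tr : K.Carrier → K.Carrier
  Tr = traceSum rawK q n

  Trₚ : Poly → Poly
  Trₚ = traceSum polySemiring q n

  IsConstant : (K.Carrier → K.Carrier) → Set (b ⊔ ℓ₃)
  IsConstant f = ∃ λ c → ∀ x → f x K.≈ c

  P : Poly → Pred K.Carrier (b ⊔ ℓ₃)
  P H γ = IsPermutationPolynomial (X +ₚ γ ·ₚ Trₚ H)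

  _𝔽q : K.Carrier → Pred K.Carrier (a ⊔ ℓ₃)
  (α 𝔽q) x = ∃ λ u → x K.≈ α K.* ι u

  record IsLinearTranslator (f : K.Carrier → K.Carrier) (s : F.Carrier)
                            (α : K.Carrier) : Set (a ⊔ b ⊔ ℓ₃) where
    field
      nonzero   : ¬ α K.≈ K.0#
      translate : ∀ x u → f (x K.+ ι u K.* α) K.- f x K.≈ ι (u F.* s)

{-# OPTIONS --safe #-}
-- Write f(x) = Tr(H(x)). Since 𝔽_{q^n} has characteristic p, the map z ↦ z^q is
-- additive, and together with y^(q^n) = y this gives f(x)^q = f(x). The q
-- elements of 𝔽_q already exhaust the roots of X^q - X, so f takes values in 𝔽_q.
-- For γ = αv with v ∈ 𝔽_q, two distinct points x and x′ collide under x + γ f(x)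
-- exactly when x′ - x = αv (f(x) - f(x′)); in particular they differ by an
-- element uα of α𝔽_q with f(x) ≠ f(x′). Conversely, from x′ = x + uα with
-- f(x′) ≠ f(x) one solves for v in 𝔽_q. Hence no collision occurs for any v if
-- and only if f is constant along the lines x + α𝔽_q.
module Submission where

open import Defs
open import Algebra.Apartness.Bundles using (HeytingField)
open import Algebra.Bundles using (CommutativeMonoid; CommutativeRing; Semiring)
open import Algebra.Morphism.Structures using (module RingMorphisms)
import Algebra.Apartness.Properties.HeytingCommutativeRing as HeytingProperties
import Algebra.Definitions.RawSemiring as RawSemiringOps
import Algebra.Properties.CommutativeMonoid.Sum as MonoidSum
import Algebra.Properties.CommutativeSemiring.Binomial as Binomial
import Algebra.Properties.CommutativeSemiring.Exp as Exp
import Algebra.Properties.Monoid.Mult as MonoidMult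
import Algebra.Properties.Ring as RingProperties
import Algebra.Properties.Semiring.Mult as Mult
import Algebra.Properties.Semiring.Sum as Sum
import Algebra.Solver.Ring.NaturalCoefficients.Default as SemiringSolver
open import Data.Fin.Base using (Fin; zero; suc; toℕ; fromℕ; inject₁; punchIn; punchOut)
open import Data.Fin.Permutation using (Permutation′; permutation; remove; punchIn-permute; _⟨$⟩ʳ_)
open import Data.Fin.Properties as Fin
  using (any?; punchInᵢ≢i; punchOut-injective; injective⇒≤; toℕ-fromℕ; toℕ-inject₁; toℕ<n)
open import Data.Nat.Base as ℕ using (ℕ; zero; suc; _≤_; _<_; s≤s; z≤n; _!; _∸_)
open import Data.Nat.Combinatorics using (_C_; nCn≡1; nCk≡n!/k![n-k]!; k![n∸k]!∣n!)
open import Data.Nat.DivMod using (m/n*n≡m)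
open import Data.Nat.Divisibility using (_∣_; divides; m∣m*n; ∣1⇒≡1; >⇒∤)
open import Data.Nat.Primality
  using (Prime; euclidsLemma; ¬prime[0]; ¬prime[1]; prime⇒nonZero; prime⇒nonTrivial)
import Data.Nat.Properties as ℕ
open import Data.Product.Base using (∃; _,_; proj₁; proj₂)
open import Data.Sum.Base using (_⊎_; inj₁; inj₂; [_,_]′; map)
open import Data.Vec.Base using (Vec; []; _∷_; replicate)
open import Data.List.Base using ([]; _∷_)
open import Function.Base using (_∘_; id)
open import Function.Bundles using (_⇔_; mk⇔; Inverse)
open import Function.Definitions using (Congruent; Injective; Bijective)
open import Relation.Binary.Bundles using (Setoid)
open import Relation.Binary.Definitions using (Decidable)
open import Relation.Binary.PropositionalEquality as ≡ using (_≡_; _≢_)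
import Relation.Binary.Reasoning.Setoid as SetoidReasoning
open import Relation.Nullary.Decidable using (Dec; yes; no; map′; decidable-stable)
open import Relation.Nullary.Negation using (¬_; contradiction)
open import Relation.Unary using (_⊆_)

-- Prime divisors of factorials and binomial coefficients.

-- By Euclid's lemma `p` would divide one of the factors of `m !`, all of which are positive and
-- smaller than `p`.
prime∤! : ∀ {p} → Prime p → ∀ {m} → m < p → ¬ p ∣ m !
prime∤! pr {zero}  _   p∣1 = ¬prime[1] (≡.subst Prime (∣1⇒≡1 p∣1) pr)
prime∤! pr {suc m} m<p p∣ with euclidsLemma (suc m) (m !) pr p∣
... | inj₁ p∣1+m = >⇒∤ m<p p∣1+m
... | inj₂ p∣m!  = prime∤! pr (ℕ.<-trans (ℕ.n<1+n m) m<p) p∣m!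

-- The prime `p` divides `p !`, which is `p C k` times `k !` times `(p ∸ k) !`. By `prime∤!` it
-- divides neither factorial, so Euclid's lemma leaves `p C k`.
prime∣C : ∀ {p k} → Prime p → 1 ≤ k → k < p → p ∣ p C k
prime∣C {zero}          pr _   _   = contradiction pr ¬prime[0]
prime∣C {p@(suc _)} {k} pr 1≤k k<p
  with euclidsLemma (p C k) (k ! ℕ.* (p ∸ k) !) pr (≡.subst (p ∣_) p!≡ (m∣m*n _))
  where
  instance _ = ℕ._!*_!≢0 k (p ∸ k)
  p!≡ : p ! ≡ (p C k) ℕ.* (k ! ℕ.* (p ∸ k) !)
  p!≡ = ≡.sym (≡.trans
    (≡.cong (ℕ._* (k ! ℕ.* (p ∸ k) !)) (nCk≡n!/k![n-k]! (ℕ.<⇒≤ k<p)))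
    (m/n*n≡m (k![n∸k]!∣n! (ℕ.<⇒≤ k<p))))
... | inj₁ p∣C = p∣C
... | inj₂ p∣k![p-k]! with euclidsLemma (k !) ((p ∸ k) !) pr p∣k![p-k]!
...   | inj₁ p∣k!     = contradiction p∣k! (prime∤! pr k<p)
...   | inj₂ p∣[p-k]! = contradiction p∣[p-k]! (prime∤! pr (ℕ.∸-monoʳ-< 1≤k (ℕ.<⇒≤ k<p)))

primePower≥2 : ∀ {q} → IsPrimePower q → 2 ≤ q
primePower≥2 (p , k , pr , 1≤k , ≡.refl) = ℕ.≤-trans
  (≡.subst (2 ≤_) (≡.sym (ℕ.*-identityʳ p)) (ℕ.nonTrivial⇒n>1 p {{prime⇒nonTrivial pr}}))
  (ℕ.^-monoʳ-≤ p {{prime⇒nonZero pr}} 1≤k)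

-- Finite sets: pigeonhole, search and reindexing.

-- Pigeonhole: if `j` were missed, punching it out would inject `Fin (suc n)` into `Fin n`.
Fin-injective⇒surjective : ∀ {n} {f : Fin n → Fin n} → Injective _≡_ _≡_ f → ∀ j → ∃ λ i → f i ≡ j
Fin-injective⇒surjective {suc n} {f} inj j with any? (λ i → f i Fin.≟ j)
... | yes found = found
... | no  ∄i    = contradiction (injective⇒≤ {f = λ i → punchOut (avoids i)} punched-injective) ℕ.1+n≰n
  where
  avoids : ∀ i → j ≢ f i
  avoids i eq = ∄i (i , ≡.sym eq)
  punched-injective : Injective _≡_ _≡_ (λ i → punchOut (avoids i))
  punched-injective eq = inj (punchOut-injective (avoids _) (avoids _) eq)

module _ {c ℓ} (S : Setoid c ℓ) {N : ℕ} (order : HasOrder S N) where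
  open Setoid S
  open Inverse order

  finite⇒decidable : Decidable _≈_
  finite⇒decidable x y = map′
    (λ eq → trans (sym (strictlyInverseʳ x)) (trans (from-cong eq) (strictlyInverseʳ y)))
    to-cong (to x Fin.≟ to y)

  -- The search meets only the representatives `from i`, so `P` has to respect `_≈_`.
  finite-∃? : ∀ {ℓ′} {P : Carrier → Set ℓ′} → (∀ {x y} → x ≈ y → P x → P y) →
              (∀ x → Dec (P x)) → Dec (∃ P)
  finite-∃? resp P? = map′ (λ (i , Pi) → from i , Pi)
    (λ (x , Px) → to x , resp (sym (strictlyInverseʳ x)) Px) (any? (P? ∘ from))

  finite-injective⇒bijective : ∀ {f} → Congruent _≈_ _≈_ f → Injective _≈_ _≈_ f → Bijective _≈_ _≈_ f
  finite-injective⇒bijective {f} f-cong f-inj = f-inj , λ y →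
    let i , eq = Fin-injective⇒surjective {f = to ∘ f ∘ from} index-injective (to y)
    in from i , λ z≈ → trans (f-cong z≈) (to-injective eq)
    where
    to-injective : Injective _≈_ _≡_ to
    to-injective eq = trans (sym (strictlyInverseʳ _)) (trans (from-cong eq) (strictlyInverseʳ _))
    index-injective : Injective _≡_ _≡_ (to ∘ f ∘ from)
    index-injective {i} {j} eq = ≡.trans (≡.sym (strictlyInverseˡ i))
      (≡.trans (to-cong (f-inj (to-injective eq))) (strictlyInverseˡ j))

  -- Turns an invertible self-map of the carrier into a permutation of indices, so that sums and
  -- products over all elements can be reindexed along it.
  finite-permutation : ∀ {f g} → Congruent _≈_ _≈_ f → Congruent _≈_ _≈_ g →
                       (∀ x → f (g x) ≈ x) → (∀ x → g (f x) ≈ x) →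
                       ∃ λ (π : Permutation′ N) → ∀ i → from (π ⟨$⟩ʳ i) ≈ f (from i)
  finite-permutation {f} {g} f-cong g-cong fg gf =
    permutation (to ∘ f ∘ from) (to ∘ g ∘ from) (round-trip f g f-cong fg) (round-trip g f g-cong gf) ,
    λ i → strictlyInverseʳ (f (from i))
    where
    round-trip : ∀ f g → Congruent _≈_ _≈_ f → (∀ x → f (g x) ≈ x) →
                 ∀ i → to (f (from (to (g (from i))))) ≡ i
    round-trip f g f-cong fg i =
      ≡.trans (to-cong (trans (f-cong (strictlyInverseʳ _)) (fg (from i)))) (strictlyInverseˡ i)

module _ {c ℓ} (M : CommutativeMonoid c ℓ) where
  open CommutativeMonoid M
  open MonoidSum M
  open MonoidMult monoid using () renaming (_×_ to _×ₙ_)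

  -- Reindexing by `π` preserves the sum, yet each term gains one `x`. The additive instance yields
  -- the characteristic; in the multiplicative one `n ×ₙ x` is a power of `x`, which yields Fermat's
  -- theorem.
  sum-translate : ∀ {n} (t : Fin n → Carrier) (π : Permutation′ n) x →
                  (∀ i → t (π ⟨$⟩ʳ i) ≈ x ∙ t i) → sum t ≈ (n ×ₙ x) ∙ sum t
  sum-translate {n} t π x eq = trans (sum-permute t π) (trans (sum-cong-≋ eq)
    (trans (∑-distrib-+ (λ _ → x) t) (∙-congʳ (sum-replicate n))))

-- Frobenius and trace sums in commutative rings.

module RingLemmas {c ℓ} (R : CommutativeRing c ℓ) where
  open CommutativeRing R hiding (zero)
  open Semiring semiring using (rawSemiring)
  open RingProperties ring using (+-cancelˡ; +-identityˡ-unique)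
  open Exp commutativeSemiring
  open Mult semiring using (×-congʳ; ×-homo-1; ×-assocˡ; ×-assoc-*) renaming (_×_ to _×ₙ_)
  open Sum semiring using (sum; sum-cong-≋; sum-init-last; sum-replicate-zero)
  open SemiringSolver commutativeSemiring using (solve; _:+_; _:*_; _:=_)
  open SetoidReasoning setoid
  open Polynomials R

  x+[y-x]≈y : ∀ x y → x + (y - x) ≈ y
  x+[y-x]≈y x y = begin
    x + (y - x)     ≈⟨ +-comm x (y - x) ⟩
    y - x + x       ≈⟨ +-assoc y (- x) x ⟩
    y + (- x + x)   ≈⟨ +-congˡ (-‿inverseˡ x) ⟩
    y + 0#          ≈⟨ +-identityʳ y ⟩
    y               ∎

  multiple-annihilates : ∀ {m n} → n ×ₙ 1# ≈ 0# → n ∣ m → ∀ x → m ×ₙ x ≈ 0#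
  multiple-annihilates {m} {n} char (divides d ≡.refl) x = begin
    (d ℕ.* n) ×ₙ x            ≈⟨ ×-congʳ (d ℕ.* n) (*-identityˡ x) ⟨
    (d ℕ.* n) ×ₙ (1# * x)     ≈⟨ ×-assoc-* (d ℕ.* n) 1# x ⟨
    ((d ℕ.* n) ×ₙ 1#) * x     ≈⟨ *-congʳ (×-assocˡ 1# d n) ⟨
    (d ×ₙ (n ×ₙ 1#)) * x      ≈⟨ ×-assoc-* d (n ×ₙ 1#) x ⟩
    d ×ₙ ((n ×ₙ 1#) * x)      ≈⟨ ×-congʳ d (trans (*-congʳ char) (zeroˡ x)) ⟩
    d ×ₙ 0#                   ≈⟨ n×0≈0 d ⟩
    0#                        ∎
    where
    n×0≈0 : ∀ n → n ×ₙ 0# ≈ 0#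
    n×0≈0 zero    = refl
    n×0≈0 (suc n) = trans (+-identityˡ _) (n×0≈0 n)

  -- In the binomial expansion every coefficient strictly between the two ends is a multiple of `p`
  -- by `prime∣C`, hence vanishes.
  frobenius-+ : ∀ {p} → Prime p → p ×ₙ 1# ≈ 0# → ∀ x y → (x + y) ^ p ≈ x ^ p + y ^ p
  frobenius-+ {zero}          pr = contradiction pr ¬prime[0]
  frobenius-+ {p@(suc m)} pr char x y = begin
    (x + y) ^ p                                      ≈⟨ theorem p x y ⟩
    term zero + sum (λ i → term (suc i))             ≈⟨ +-cong first (sum-init-last (λ i → term (suc i))) ⟩
    -- Among the indices 0 to `p`, `zero` has been split off. Since `p` is `suc m`, the indices
    -- `suc (inject₁ i)` run through 1 to `p` - 1, and `suc (fromℕ m)` is `p` itself.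
    y ^ p + (sum (λ i → term (suc (inject₁ i))) + term (suc (fromℕ m)))
      ≈⟨ +-congˡ (+-cong (trans (sum-cong-≋ middle) (sum-replicate-zero m)) last) ⟩
    y ^ p + (0# + x ^ p)                             ≈⟨ +-congˡ (+-identityˡ (x ^ p)) ⟩
    y ^ p + x ^ p                                    ≈⟨ +-comm (y ^ p) (x ^ p) ⟩
    x ^ p + y ^ p                                    ∎
    where
    open Binomial commutativeSemiring using (theorem; binomialTerm)
    term = binomialTerm x y p
    first : term zero ≈ y ^ p
    first = trans (×-homo-1 _) (*-identityˡ (y ^ p))
    last : term (suc (fromℕ m)) ≈ x ^ p
    last rewrite toℕ-fromℕ m | nCn≡1 p | ℕ.n∸n≡0 m = trans (×-homo-1 _) (*-identityʳ (x ^ p))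
    middle : ∀ i → term (suc (inject₁ i)) ≈ 0#
    middle i rewrite toℕ-inject₁ i =
      multiple-annihilates char (prime∣C pr (s≤s z≤n) (s≤s (toℕ<n i))) _

  frobenius^-+ : ∀ {p} → Prime p → p ×ₙ 1# ≈ 0# → ∀ k x y →
                 (x + y) ^ (p ℕ.^ k) ≈ x ^ (p ℕ.^ k) + y ^ (p ℕ.^ k)
  frobenius^-+ pr char zero    x y =
    trans (*-identityʳ _) (sym (+-cong (*-identityʳ x) (*-identityʳ y)))
  frobenius^-+ {p} pr char (suc k) x y = begin
    (x + y) ^ (p ℕ.* p ℕ.^ k)                ≈⟨ ^-assocʳ (x + y) p (p ℕ.^ k) ⟨
    ((x + y) ^ p) ^ (p ℕ.^ k)                ≈⟨ ^-congˡ (p ℕ.^ k) (frobenius-+ pr char x y) ⟩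
    (x ^ p + y ^ p) ^ (p ℕ.^ k)              ≈⟨ frobenius^-+ pr char k (x ^ p) (y ^ p) ⟩
    (x ^ p) ^ (p ℕ.^ k) + (y ^ p) ^ (p ℕ.^ k)
      ≈⟨ +-cong (^-assocʳ x p (p ℕ.^ k)) (^-assocʳ y p (p ℕ.^ k)) ⟩
    x ^ (p ℕ.* p ℕ.^ k) + y ^ (p ℕ.* p ℕ.^ k) ∎

  sum-^ : ∀ q → (∀ x y → (x + y) ^ q ≈ x ^ q + y ^ q) →
          ∀ {n} (t : Fin n → Carrier) → sum t ^ q ≈ sum (λ i → t i ^ q)
  -- The empty sum requires `0# ^ q` to vanish. Additivity at 0 gives `0# ^ q + 0# ^ q ≈ 0# ^ q`,
  -- which settles this without a case split on `q`.
  sum-^ q q-additive {zero}  t = +-identityˡ-unique (0# ^ q) (0# ^ q)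
    (trans (sym (q-additive 0# 0#)) (^-congˡ q (+-identityˡ 0#)))
  sum-^ q q-additive {suc n} t =
    trans (q-additive (t zero) _) (+-congˡ (sum-^ q q-additive (t ∘ suc)))

  -- The `q`-th power shifts the summands x, x^q, ... cyclically, since x^(q^n) = x. To avoid
  -- reindexing, `x` is added to both sides: each becomes the sum of x^(q^i) for i from 0 to n,
  -- split at its first or at its last term.
  traceSum-^ : ∀ q n → (∀ x y → (x + y) ^ q ≈ x ^ q + y ^ q) →
               ∀ {x} → x ^ (q ℕ.^ n) ≈ x →
               traceSum rawSemiring q n x ^ q ≈ traceSum rawSemiring q n x
  traceSum-^ q n q-additive {x} x-fixed = +-cancelˡ x _ _ (begin
    x + trace ^ q
      ≈⟨ +-cong (sym (*-identityʳ x)) (trans (sum-^ q q-additive {n} _) (sum-cong-≋ {n} step)) ⟩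
    sum s
      ≈⟨ sum-init-last s ⟩
    sum (λ i → s (inject₁ i)) + s (fromℕ n)
      ≈⟨ +-cong (sum-cong-≋ {n} (λ i → ^-congʳ x (≡.cong (q ℕ.^_) (toℕ-inject₁ i))))
                (trans (^-congʳ x (≡.cong (q ℕ.^_) (toℕ-fromℕ n))) x-fixed) ⟩
    trace + x
      ≈⟨ +-comm trace x ⟩
    x + trace ∎)
    where
    trace = traceSum rawSemiring q n x
    s : Fin (suc n) → Carrier
    s i = x ^ (q ℕ.^ toℕ i)
    step : ∀ i → (x ^ (q ℕ.^ toℕ i)) ^ q ≈ s (suc i)
    step i = trans (^-assocʳ x (q ℕ.^ toℕ i) q) (^-congʳ x (ℕ.*-comm (q ℕ.^ toℕ i) q))

  traceSum-cong : ∀ q n {x y} → x ≈ y → traceSum rawSemiring q n x ≈ traceSum rawSemiring q n y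
  traceSum-cong q n x≈y = sum-cong-≋ {n} (λ i → ^-congˡ (q ℕ.^ toℕ i) x≈y)

  -- Evaluation of polynomials.

  eval-cong : ∀ f {x y} → x ≈ y → eval f x ≈ eval f y
  eval-cong []      x≈y = refl
  eval-cong (a ∷ f) x≈y = +-congˡ (*-cong x≈y (eval-cong f x≈y))

  eval-+ₚ : ∀ f g x → eval (f +ₚ g) x ≈ eval f x + eval g x
  eval-+ₚ []      g       x = sym (+-identityˡ _)
  eval-+ₚ (a ∷ f) []      x = sym (+-identityʳ _)
  eval-+ₚ (a ∷ f) (b ∷ g) x = trans (+-congˡ (*-congˡ (eval-+ₚ f g x)))
    (solve 5 (λ a b x F G → (a :+ b) :+ x :* (F :+ G) := (a :+ x :* F) :+ (b :+ x :* G))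
      refl a b x (eval f x) (eval g x))

  eval-·ₚ : ∀ a f x → eval (a ·ₚ f) x ≈ a * eval f x
  eval-·ₚ a []      x = sym (zeroʳ a)
  eval-·ₚ a (b ∷ f) x = trans (+-congˡ (*-congˡ (eval-·ₚ a f x)))
    (solve 4 (λ a b x F → a :* b :+ x :* (a :* F) := a :* (b :+ x :* F)) refl a b x (eval f x))

  eval-*ₚ : ∀ f g x → eval (f *ₚ g) x ≈ eval f x * eval g x
  eval-*ₚ []      g x = sym (zeroˡ _)
  eval-*ₚ (a ∷ f) g x = begin
    eval (a ·ₚ g +ₚ (0# ∷ f *ₚ g)) x               ≈⟨ eval-+ₚ (a ·ₚ g) (0# ∷ f *ₚ g) x ⟩
    eval (a ·ₚ g) x + (0# + x * eval (f *ₚ g) x)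
      ≈⟨ +-cong (eval-·ₚ a g x) (trans (+-identityˡ _) (*-congˡ (eval-*ₚ f g x))) ⟩
    a * eval g x + x * (eval f x * eval g x)
      ≈⟨ solve 4 (λ a x F G → a :* G :+ x :* (F :* G) := (a :+ x :* F) :* G) refl a x (eval f x) (eval g x) ⟩
    (a + x * eval f x) * eval g x                  ∎

  open RawSemiringOps polySemiring using () renaming (_^_ to _^ₚ_; sum to sumₚ)

  eval-1ₚ : ∀ x → eval (1# ∷ []) x ≈ 1#
  eval-1ₚ x = trans (+-congˡ (zeroʳ x)) (+-identityʳ 1#)

  eval-^ₚ : ∀ f n x → eval (f ^ₚ n) x ≈ eval f x ^ n
  eval-^ₚ f zero    x = eval-1ₚ x
  eval-^ₚ f (suc n) x = trans (eval-*ₚ f (f ^ₚ n) x) (*-congˡ (eval-^ₚ f n x))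

  eval-sumₚ : ∀ {n} (t : Fin n → Poly) x → eval (sumₚ t) x ≈ sum (λ i → eval (t i) x)
  eval-sumₚ {zero}  t x = refl
  eval-sumₚ {suc n} t x = trans (eval-+ₚ (t zero) (sumₚ (t ∘ suc)) x) (+-congˡ (eval-sumₚ (t ∘ suc) x))

  eval-traceSum : ∀ q n f x →
                  eval (traceSum polySemiring q n f) x ≈ traceSum rawSemiring q n (eval f x)
  eval-traceSum q n f x =
    trans (eval-sumₚ {n} _ x) (sum-cong-≋ {n} (λ i → eval-^ₚ f (q ℕ.^ toℕ i) x))

  eval-X : ∀ x → eval X x ≈ x
  eval-X x = trans (+-identityˡ _) (trans (*-congˡ (eval-1ₚ x)) (*-identityʳ x))

  -- Roots of monic polynomials.

  -- A vector of length d stands for the monic polynomial of degree d with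
  -- these lower coefficients, in order of increasing degree.
  evalMonic : ∀ {d} → Vec Carrier d → Carrier → Carrier
  evalMonic []      x = 1#
  evalMonic (a ∷ f) x = a + x * evalMonic f x

  evalMonic-cong : ∀ {d} (f : Vec Carrier d) {x y} → x ≈ y → evalMonic f x ≈ evalMonic f y
  evalMonic-cong []      x≈y = refl
  evalMonic-cong (a ∷ f) x≈y = +-congˡ (*-cong x≈y (evalMonic-cong f x≈y))

  -- Horner's scheme for division by X - r: the quotient's coefficients are the values at `r` of the
  -- successive tails of `f`. The last, empty tail has value 1, the implicit leading coefficient of
  -- the quotient.
  syntheticQuotient : ∀ {d} → Vec Carrier (suc d) → Carrier → Vec Carrier d
  syntheticQuotient (a ∷ [])        r = []
  syntheticQuotient (a ∷ f@(_ ∷ _)) r = evalMonic f r ∷ syntheticQuotient f r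

  -- Stated with x = r + δ, so that it is a semiring identity.
  syntheticDivision : ∀ {d} (f : Vec Carrier (suc d)) r δ →
    evalMonic f (r + δ) ≈ evalMonic f r + δ * evalMonic (syntheticQuotient f r) (r + δ)
  syntheticDivision (a ∷ [])        r δ = trans (+-congˡ (distribʳ 1# r δ)) (sym (+-assoc a _ _))
  syntheticDivision (a ∷ f@(_ ∷ _)) r δ = trans (+-congˡ (*-congˡ (syntheticDivision f r δ)))
    (solve 5 (λ a r δ F G → a :+ (r :+ δ) :* (F :+ δ :* G) := (a :+ r :* F) :+ δ :* (F :+ (r :+ δ) :* G))
      refl a r δ (evalMonic f r) (evalMonic (syntheticQuotient f r) (r + δ)))

  module IntegralDomain (1≉0 : ¬ 1# ≈ 0#) (integral : ∀ x y → x * y ≈ 0# → x ≈ 0# ⊎ y ≈ 0#) where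

    x^n≈0⇒x≈0 : ∀ {x} n → x ^ n ≈ 0# → x ≈ 0#
    x^n≈0⇒x≈0 zero    1≈0 = contradiction 1≈0 1≉0
    x^n≈0⇒x≈0 {x} (suc n) x^≈0 = [ id , x^n≈0⇒x≈0 n ]′ (integral x (x ^ n) x^≈0)

    -- When f(r) = f(z) = 0, synthetic division leaves (z - r) g(z) = 0 for the quotient g, and
    -- there are no zero divisors.
    other-root : ∀ {d} (f : Vec Carrier (suc d)) {r z} → evalMonic f r ≈ 0# → evalMonic f z ≈ 0# →
                 z ≈ r ⊎ evalMonic (syntheticQuotient f r) z ≈ 0#
    other-root f {r} {z} fr≈0 fz≈0 = map δ≈0⇒z≈r id (integral δ (evalMonic g z) (begin
      δ * evalMonic g z                       ≈⟨ *-congˡ (evalMonic-cong g r+δ≈z) ⟨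
      δ * evalMonic g (r + δ)                 ≈⟨ +-identityˡ _ ⟨
      0# + δ * evalMonic g (r + δ)            ≈⟨ +-congʳ fr≈0 ⟨
      evalMonic f r + δ * evalMonic g (r + δ) ≈⟨ syntheticDivision f r δ ⟨
      evalMonic f (r + δ)                     ≈⟨ evalMonic-cong f r+δ≈z ⟩
      evalMonic f z                           ≈⟨ fz≈0 ⟩
      0#                                      ∎))
      where
      g = syntheticQuotient f r
      δ = z - r
      r+δ≈z = x+[y-x]≈y r z
      δ≈0⇒z≈r : δ ≈ 0# → z ≈ r
      δ≈0⇒z≈r δ≈0 = trans (sym r+δ≈z) (trans (+-congˡ δ≈0) (+-identityʳ r))

    -- A monic polynomial of degree `d` has at most `d` roots. Dividing by X - r₀ lowers the degree;
    -- the remaining `r i` differ from r₀ and so are roots of the quotient. In degree 0 the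
    -- polynomial is 1, which has no root.
    roots-exhaustive : ∀ {d} (f : Vec Carrier d) (r : Fin d → Carrier) → Injective _≡_ _≈_ r →
                       (∀ i → evalMonic f (r i) ≈ 0#) → ∀ z → evalMonic f z ≈ 0# → ∃ λ i → z ≈ r i
    roots-exhaustive {zero}  [] r r-inj roots z 1≈0 = contradiction 1≈0 1≉0
    roots-exhaustive {suc d} f  r r-inj roots z fz≈0 with other-root f (roots zero) fz≈0
    ... | inj₁ z≈r₀ = zero , z≈r₀
    ... | inj₂ gz≈0 =
      let i , z≈rᵢ = roots-exhaustive (syntheticQuotient f (r zero)) (r ∘ suc)
                       (Fin.suc-injective ∘ r-inj) quotient-roots z gz≈0
      in suc i , z≈rᵢ
      where
      quotient-roots : ∀ i → evalMonic (syntheticQuotient f (r zero)) (r (suc i)) ≈ 0#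
      quotient-roots i with other-root f (roots zero) (roots (suc i))
      ... | inj₁ rᵢ≈r₀ = contradiction (r-inj rᵢ≈r₀) λ ()
      ... | inj₂ g≈0   = g≈0

    -- The fixed points are the roots of X^q - X. The bound `2 ≤ q` places the term -X strictly
    -- below the leading one, so the polynomial is monic of degree `q`.
    ^-fixed-exhaustive : ∀ {q} → 2 ≤ q → (r : Fin q → Carrier) → Injective _≡_ _≈_ r →
                         (∀ i → r i ^ q ≈ r i) → ∀ {z} → z ^ q ≈ z → ∃ λ i → z ≈ r i
    ^-fixed-exhaustive {suc (suc m)} (s≤s (s≤s _)) r r-inj fixed z-fixed =
      roots-exhaustive X^q-X r r-inj (λ i → fixed⇒root (fixed i)) _ (fixed⇒root z-fixed)
      where
      X^q-X : Vec Carrier (suc (suc m))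
      X^q-X = 0# ∷ - 1# ∷ replicate m 0#
      evalMonic-power : ∀ m x → evalMonic (replicate m 0#) x ≈ x ^ m
      evalMonic-power zero    x = refl
      evalMonic-power (suc m) x = trans (+-identityˡ _) (*-congˡ (evalMonic-power m x))
      fixed⇒root : ∀ {x} → x ^ suc (suc m) ≈ x → evalMonic X^q-X x ≈ 0#
      fixed⇒root {x} x-fixed = begin
        0# + x * (- 1# + x * evalMonic (replicate m 0#) x)
          ≈⟨ +-identityˡ _ ⟩
        x * (- 1# + x * evalMonic (replicate m 0#) x)
          ≈⟨ *-congˡ (+-congˡ (*-congˡ (evalMonic-power m x))) ⟩
        x * (- 1# + x ^ suc m)
          ≈⟨ distribˡ x (- 1#) (x ^ suc m) ⟩
        x * - 1# + x ^ suc (suc m)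
          ≈⟨ +-congˡ (trans x-fixed (sym (*-identityʳ x))) ⟩
        x * - 1# + x * 1#
          ≈⟨ distribˡ x (- 1#) 1# ⟨
        x * (- 1# + 1#)
          ≈⟨ *-congˡ (-‿inverseˡ 1#) ⟩
        x * 0#
          ≈⟨ zeroʳ x ⟩
        0# ∎

-- Finite fields: inverses, characteristic and Frobenius.

module FiniteFieldLemmas {c ℓ₁ ℓ₂} (F : HeytingField c ℓ₁ ℓ₂) {N : ℕ}
                         (order : HasOrder (CommutativeRing.setoid (fieldRing F)) N) where
  open CommutativeRing (fieldRing F) hiding (zero)
  open HeytingField F using (heytingCommutativeRing; tight; #⇒invertible)
  open HeytingProperties heytingCommutativeRing using (1#0; x-0≈x)
  open RingProperties ring using (+-identityˡ-unique)
  open Exp commutativeSemiring using (_^_)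
  open Mult semiring using (×1-homo-*; ×-homo-1; ×-congˡ) renaming (_×_ to _×ₙ_)
  open MonoidSum *-commutativeMonoid using () renaming (sum to product)
  open RingLemmas (fieldRing F)
  open Inverse order
  open SetoidReasoning setoid

  _≟_ : Decidable _≈_
  _≟_ = finite⇒decidable setoid order

  1≉0 : ¬ 1# ≈ 0#
  1≉0 1≈0 = proj₂ (tight 1# 0#) 1≈0 1#0

  -- Apartness from 0 is only doubly negated here; the inverse is found by
  -- searching the finite carrier.
  nonzero⇒leftInvertible : ∀ x → ¬ x ≈ 0# → ∃ λ y → y * x ≈ 1#
  nonzero⇒leftInvertible x x≉0 = decidable-stable
    (finite-∃? setoid order (λ y≈z → trans (*-congʳ (sym y≈z))) (λ y → (y * x) ≟ 1#))
    λ ∄y → x≉0 (proj₁ (tight x 0#) λ x#0 →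
      let y , y[x-0]≈1 , _ = #⇒invertible x#0
      in ∄y (y , trans (*-congˡ (sym (x-0≈x x))) y[x-0]≈1))

  integral : ∀ x y → x * y ≈ 0# → x ≈ 0# ⊎ y ≈ 0#
  integral x y xy≈0 with x ≟ 0#
  ... | yes x≈0 = inj₁ x≈0
  ... | no  x≉0 = let x⁻¹ , x⁻¹x≈1 = nonzero⇒leftInvertible x x≉0 in inj₂ (begin
    y               ≈⟨ *-identityˡ y ⟨
    1# * y          ≈⟨ *-congʳ x⁻¹x≈1 ⟨
    x⁻¹ * x * y     ≈⟨ *-assoc x⁻¹ x y ⟩
    x⁻¹ * (x * y)   ≈⟨ *-congˡ xy≈0 ⟩
    x⁻¹ * 0#        ≈⟨ zeroʳ x⁻¹ ⟩
    0#              ∎)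

  open IntegralDomain 1≉0 integral public

  product≉0 : ∀ {n} (t : Fin n → Carrier) → (∀ i → ¬ t i ≈ 0#) → ¬ product t ≈ 0#
  product≉0 {zero}  t t≉0 = 1≉0
  product≉0 {suc n} t t≉0 = [ t≉0 zero , product≉0 (t ∘ suc) (t≉0 ∘ suc) ]′ ∘ integral _ _

  xy≈y⇒x≈1 : ∀ {x y} → ¬ y ≈ 0# → x * y ≈ y → x ≈ 1#
  xy≈y⇒x≈1 {x} {y} y≉0 xy≈y = let y⁻¹ , y⁻¹y≈1 = nonzero⇒leftInvertible y y≉0 in begin
    x               ≈⟨ *-identityʳ x ⟨
    x * 1#          ≈⟨ *-congˡ (trans (*-comm y y⁻¹) y⁻¹y≈1) ⟨
    x * (y * y⁻¹)   ≈⟨ *-assoc x y y⁻¹ ⟨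
    x * y * y⁻¹     ≈⟨ *-congʳ xy≈y ⟩
    y * y⁻¹         ≈⟨ trans (*-comm y y⁻¹) y⁻¹y≈1 ⟩
    1#              ∎

  -- Translation by 1 permutes the field, so the sum S of all elements satisfies S = N · 1 + S.
  order×1≈0 : N ×ₙ 1# ≈ 0#
  order×1≈0 =
    let π , from-π = finite-permutation setoid order {1# +_} {_- 1#} +-congˡ +-congʳ
                       (x+[y-x]≈y 1#)
                       (λ x → trans (+-assoc 1# x (- 1#)) (x+[y-x]≈y 1# x))
    in +-identityˡ-unique _ _ (sym (sum-translate +-commutativeMonoid from π 1# from-π))

  -- Here p^m · 1 = (p · 1)^m vanishes by `order×1≈0`, and a field has no nonzero nilpotents.
  primePowerOrder⇒characteristic : ∀ {p} m → N ≡ p ℕ.^ m → p ×ₙ 1# ≈ 0#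
  primePowerOrder⇒characteristic {p} m N≡p^m = x^n≈0⇒x≈0 m
    (trans (sym (×1-homo-^ m)) (trans (×-congˡ (≡.sym N≡p^m)) order×1≈0))
    where
    ×1-homo-^ : ∀ m → (p ℕ.^ m) ×ₙ 1# ≈ (p ×ₙ 1#) ^ m
    ×1-homo-^ zero    = ×-homo-1 1#
    ×1-homo-^ (suc m) = trans (×1-homo-* p (p ℕ.^ m)) (*-congˡ (×1-homo-^ m))

  -- For q = p^k the order is p^(kn), so `p` annihilates 1 and the `q`-th power is the `k`-fold
  -- iterate of Frobenius.
  ^-primePower-additive : ∀ {q} → IsPrimePower q → ∀ n → N ≡ q ℕ.^ n →
                          ∀ x y → (x + y) ^ q ≈ x ^ q + y ^ q
  ^-primePower-additive (p , k , p-prime , _ , ≡.refl) n N≡q^n = frobenius^-+ p-prime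
    (primePowerOrder⇒characteristic (k ℕ.* n) (≡.trans N≡q^n (ℕ.^-*-assoc p k n))) k

-- Fermat's theorem for finite fields.

module _ {c ℓ₁ ℓ₂} (F : HeytingField c ℓ₁ ℓ₂) where
  open CommutativeRing (fieldRing F) hiding (zero)
  open Exp commutativeSemiring using (_^_)
  open MonoidSum *-commutativeMonoid using () renaming (sum to product)
  open SetoidReasoning setoid

  -- Multiplication by a nonzero `x` permutes the `m` nonzero elements, so their product Q satisfies
  -- Q = x^m Q. As Q is nonzero, x^m = 1, and one more factor `x` gives the claim.
  fermat : ∀ {N} → HasOrder setoid N → ∀ x → x ^ N ≈ x
  fermat {zero}  order x = contradiction (Inverse.to order 0#) Fin.¬Fin0
  fermat {suc m} order x with FiniteFieldLemmas._≟_ F order x 0#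
  ... | yes x≈0 = trans (*-congʳ x≈0) (trans (zeroˡ _) (sym x≈0))
  ... | no  x≉0 = trans (*-congˡ (xy≈y⇒x≈1 (product≉0 t t≉0) (sym
                    (sum-translate *-commutativeMonoid t (remove i₀ π) x t-π))))
                    (*-identityʳ x)
    where
    open FiniteFieldLemmas F order
    open Inverse order
    x⁻¹ = proj₁ (nonzero⇒leftInvertible x x≉0)
    x⁻¹x≈1 = proj₂ (nonzero⇒leftInvertible x x≉0)
    cancel : ∀ {a b} → a * b ≈ 1# → ∀ y → a * (b * y) ≈ y
    cancel ab≈1 y = trans (sym (*-assoc _ _ y)) (trans (*-congʳ ab≈1) (*-identityˡ y))
    multiplication = finite-permutation setoid order {x *_} {x⁻¹ *_} *-congˡ *-congˡ
                       (cancel (trans (*-comm x x⁻¹) x⁻¹x≈1)) (cancel x⁻¹x≈1)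
    π = proj₁ multiplication
    from-π = proj₂ multiplication
    i₀ = to 0#
    -- Skipping the index `i₀` of 0 enumerates exactly the nonzero elements.
    t : Fin m → Carrier
    t j = from (punchIn i₀ j)
    t≉0 : ∀ j → ¬ t j ≈ 0#
    t≉0 j tj≈0 = punchInᵢ≢i i₀ j (≡.trans (≡.sym (strictlyInverseˡ _)) (to-cong tj≈0))
    -- Since x · 0 = 0, the permutation fixes `i₀`, so `remove i₀ π` still describes multiplication
    -- by `x` on the nonzero elements.
    πi₀≡i₀ : π ⟨$⟩ʳ i₀ ≡ i₀
    πi₀≡i₀ = ≡.trans (≡.sym (strictlyInverseˡ _))
      (to-cong (trans (from-π i₀) (trans (*-congˡ (strictlyInverseʳ 0#)) (zeroʳ x))))
    t-π : ∀ j → t (remove i₀ π ⟨$⟩ʳ j) ≈ x * t j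
    t-π j = begin
      from (punchIn i₀ (remove i₀ π ⟨$⟩ʳ j))
        ≡⟨ ≡.cong (λ i → from (punchIn i (remove i₀ π ⟨$⟩ʳ j))) πi₀≡i₀ ⟨
      from (punchIn (π ⟨$⟩ʳ i₀) (remove i₀ π ⟨$⟩ʳ j))
        ≡⟨ ≡.cong from (punchIn-permute π i₀ j) ⟨
      from (π ⟨$⟩ʳ punchIn i₀ j)
        ≈⟨ from-π (punchIn i₀ j) ⟩
      x * t j ∎

-- The image of the base field and the values of the trace.

module TraceLemmas {q n a ℓ₁ ℓ₂ b ℓ₃ ℓ₄} (isPrimePower : IsPrimePower q)
                   (E : FiniteFieldExtension q n a ℓ₁ ℓ₂ b ℓ₃ ℓ₄) where
  open Extension E
  open RingMorphisms F.rawRing K.rawRing using (module IsRingHomomorphism)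
  open IsRingHomomorphism ι-hom
  module FF = FiniteFieldLemmas baseField F-order
  module FK = FiniteFieldLemmas topField K-order
  module RK = RingLemmas (fieldRing topField)
  module ExpF = Exp F.commutativeSemiring
  module ExpK = Exp K.commutativeSemiring

  ι-sub : ∀ u v → ι (u F.- v) K.≈ ι u K.- ι v
  ι-sub u v = K.trans (+-homo u (F.- v)) (K.+-congˡ (-‿homo v))

  -- If `ι` identified distinct elements, their difference would be invertible and yet map to 0,
  -- forcing 1 = 0 in the top field.
  ι-injective : Injective F._≈_ K._≈_ ι
  ι-injective {u} {v} ιu≈ιv = decidable-stable (u FF.≟ v) λ u≉v →
    let d = u F.- v
        d⁻¹ , d⁻¹d≈1 = FF.nonzero⇒leftInvertible d (u≉v ∘ RingProperties.x∙y⁻¹≈ε⇒x≈y F.ring u v)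
    in FK.1≉0 (begin
      K.1#              ≈⟨ 1#-homo ⟨
      ι F.1#            ≈⟨ ⟦⟧-cong d⁻¹d≈1 ⟨
      ι (d⁻¹ F.* d)     ≈⟨ *-homo d⁻¹ d ⟩
      ι d⁻¹ K.* ι d     ≈⟨ K.*-congˡ (K.trans (ι-sub u v) (RingProperties.x≈y⇒x∙y⁻¹≈ε K.ring ιu≈ιv)) ⟩
      ι d⁻¹ K.* K.0#    ≈⟨ K.zeroʳ _ ⟩
      K.0#              ∎)
    where open SetoidReasoning K.setoid

  ι-^ : ∀ u m → ι (u ExpF.^ m) K.≈ ι u ExpK.^ m
  ι-^ u zero    = 1#-homo
  ι-^ u (suc m) = K.trans (*-homo u _) (K.*-congˡ (ι-^ u m))

  -- By Fermat's theorem in the base field, `ι` supplies `q` distinct fixed points of the `q`-th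
  -- power, as many as X^q - X can have.
  ι-exhausts-^-fixed : ∀ {z} → z ExpK.^ q K.≈ z → ∃ λ u → z K.≈ ι u
  ι-exhausts-^-fixed z-fixed =
    let i , z≈ = FK.^-fixed-exhaustive (primePower≥2 isPrimePower) (ι ∘ from)
                   from-ι-injective fixed z-fixed
    in from i , z≈
    where
    open Inverse F-order
    from-ι-injective : Injective _≡_ K._≈_ (ι ∘ from)
    from-ι-injective eq = ≡.trans (≡.sym (strictlyInverseˡ _))
      (≡.trans (to-cong (ι-injective eq)) (strictlyInverseˡ _))
    fixed : ∀ i → ι (from i) ExpK.^ q K.≈ ι (from i)
    fixed i = K.trans (K.sym (ι-^ (from i) q)) (⟦⟧-cong (fermat baseField F-order (from i)))

  Tr-in-image : ∀ y → ∃ λ u → Tr y K.≈ ι u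
  Tr-in-image y = ι-exhausts-^-fixed (RK.traceSum-^ q n
    (FK.^-primePower-additive isPrimePower n ≡.refl) (fermat topField K-order y))

  -- Collisions along the line α𝔽_q.

  module _ (H : Poly) (α : K.Carrier) where
    private
      f : K.Carrier → K.Carrier
      f x = Tr (eval H x)

      -- The values of `f` read in 𝔽_q itself, where the scalars `w` and `v` below have to be
      -- formed.
      φ : K.Carrier → F.Carrier
      φ x = proj₁ (Tr-in-image (eval H x))

      f≈ιφ : ∀ x → f x K.≈ ι (φ x)
      f≈ιφ x = proj₂ (Tr-in-image (eval H x))

      f-cong : Congruent K._≈_ K._≈_ f
      f-cong x≈y = RK.traceSum-cong q n (RK.eval-cong H x≈y)

      ι-φ-difference : ∀ x y → ι (φ x F.- φ y) K.≈ f x K.- f y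
      ι-φ-difference x y = K.trans (ι-sub (φ x) (φ y))
        (K.+-cong (K.sym (f≈ιφ x)) (K.-‿cong (K.sym (f≈ιφ y))))

    open RingProperties K.ring using (x∙y⁻¹≈ε⇒x≈y; x≈y⇒x∙y⁻¹≈ε; +-cancelʳ)
    open SetoidReasoning K.setoid

    eval-X+γTr : ∀ γ x → eval (X +ₚ γ ·ₚ Trₚ H) x K.≈ x K.+ γ K.* f x
    eval-X+γTr γ x = K.trans (RK.eval-+ₚ X (γ ·ₚ Trₚ H) x) (K.+-cong (RK.eval-X x)
      (K.trans (RK.eval-·ₚ γ (Trₚ H) x) (K.*-congˡ (RK.eval-traceSum q n H x))))

    -- On a finite field injectivity suffices. A collision of `x` and `y` puts `x` on the line
    -- through `y` in direction `α`, where `f` is constant; then γ f(x) = γ f(y) cancels and x = y.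
    translator⇒line⊆P : IsLinearTranslator f F.0# α → (α 𝔽q) ⊆ P H
    translator⇒line⊆P translator {γ} (u , γ≈αιu) =
      finite-injective⇒bijective K.setoid K-order (RK.eval-cong (X +ₚ γ ·ₚ Trₚ H)) λ {x} {y} eq →
        let equation = K.trans (K.sym (eval-X+γTr γ x)) (K.trans eq (eval-X+γTr γ y))
        in +-cancelʳ (γ K.* f x) x y (K.trans equation (K.+-congˡ (K.*-congˡ (K.sym (same-value equation)))))
      where
      open IsLinearTranslator translator
      f-invariant : ∀ x w → f (x K.+ ι w K.* α) K.≈ f x
      f-invariant x w = x∙y⁻¹≈ε⇒x≈y _ _
        (K.trans (translate x w) (K.trans (⟦⟧-cong (F.zeroʳ w)) 0#-homo))
      same-value : ∀ {x y} → x K.+ γ K.* f x K.≈ y K.+ γ K.* f y → f x K.≈ f y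
      same-value {x} {y} equation = K.trans (f-cong x≈y+ιwα) (f-invariant y w)
        where
        -- The collision says x - y = γ (f(y) - f(x)); with γ = αu this is the multiple of `α` by
        -- `w`.
        w = u F.* (φ y F.- φ x)
        δ = f y K.- f x
        x≈y+ιwα : x K.≈ y K.+ ι w K.* α
        x≈y+ιwα = +-cancelʳ (γ K.* f x) _ _ (begin
          x K.+ γ K.* f x
            ≈⟨ equation ⟩
          y K.+ γ K.* f y
            -- Writing f(y) as f(x) + δ exposes a summand γ f(x) on both sides, ready for
            -- cancellation.
            ≈⟨ K.+-congˡ (K.*-congˡ (RK.x+[y-x]≈y (f x) (f y))) ⟨
          y K.+ γ K.* (f x K.+ δ)
            ≈⟨ K.trans (K.+-congˡ (K.trans (K.distribˡ γ (f x) δ) (K.+-comm _ _))) (K.sym (K.+-assoc y _ _)) ⟩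
          y K.+ γ K.* δ K.+ γ K.* f x
            ≈⟨ K.+-congʳ (K.+-congˡ γδ≈ιwα) ⟩
          y K.+ ι w K.* α K.+ γ K.* f x ∎)
          where
          γδ≈ιwα : γ K.* δ K.≈ ι w K.* α
          γδ≈ιwα = begin
            γ K.* δ                            ≈⟨ K.*-cong γ≈αιu (K.sym (ι-φ-difference y x)) ⟩
            α K.* ι u K.* ι (φ y F.- φ x)      ≈⟨ K.*-assoc α _ _ ⟩
            α K.* (ι u K.* ι (φ y F.- φ x))    ≈⟨ K.*-comm α _ ⟩
            ι u K.* ι (φ y F.- φ x) K.* α      ≈⟨ K.*-congʳ (*-homo u _) ⟨
            ι w K.* α                          ∎

    -- If d = f(x) - f(x + uα) were nonzero, then for γ = α(u/d) the points x
    -- and x + uα would have the same image under x + γ f(x).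
    line⊆P⇒translator : ¬ α K.≈ K.0# → (α 𝔽q) ⊆ P H → IsLinearTranslator f F.0# α
    line⊆P⇒translator α≉0 line⊆P = record
      { nonzero   = α≉0
      ; translate = λ x u → K.trans (x≈y⇒x∙y⁻¹≈ε (invariant x u))
                      (K.sym (K.trans (⟦⟧-cong (F.zeroʳ u)) 0#-homo))
      }
      where
      invariant : ∀ x u → f (x K.+ ι u K.* α) K.≈ f x
      -- Equality in a finite field is decidable, so arguing by contradiction is constructive here.
      invariant x u = decidable-stable (f x′ FK.≟ f x) λ fx′≉fx →
        let d⁻¹ , d⁻¹d≈1 = FF.nonzero⇒leftInvertible d (fx′≉fx ∘ d≈0⇒same-value)
        in fx′≉fx (f-cong (collision d⁻¹ d⁻¹d≈1))
        where
        x′ = x K.+ ι u K.* α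
        d = φ x F.- φ x′
        δ = f x K.- f x′
        -- Contrapositively, f(x′) ≠ f(x) makes `d` invertible in 𝔽_q and not merely in the top
        -- field, which keeps γ on the line α𝔽_q.
        d≈0⇒same-value : d F.≈ F.0# → f x′ K.≈ f x
        d≈0⇒same-value d≈0 = K.sym (x∙y⁻¹≈ε⇒x≈y _ _ (begin
          f x K.- f x′   ≈⟨ ι-φ-difference x x′ ⟨
          ι d            ≈⟨ ⟦⟧-cong d≈0 ⟩
          ι F.0#         ≈⟨ 0#-homo ⟩
          K.0#           ∎))
        collision : ∀ d⁻¹ → d⁻¹ F.* d F.≈ F.1# → x′ K.≈ x
        collision d⁻¹ d⁻¹d≈1 = proj₁ (line⊆P (v , K.refl)) (begin
          eval (X +ₚ γ ·ₚ Trₚ H) x′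
            ≈⟨ eval-X+γTr γ x′ ⟩
          x K.+ ι u K.* α K.+ γ K.* f x′
            ≈⟨ K.+-congʳ (K.+-congˡ ιuα≈γδ) ⟩
          x K.+ γ K.* δ K.+ γ K.* f x′
            ≈⟨ K.trans (K.+-assoc x _ _) (K.+-congˡ (K.trans (K.+-comm _ _) (K.sym (K.distribˡ γ _ _)))) ⟩
          x K.+ γ K.* (f x′ K.+ δ)
            ≈⟨ K.+-congˡ (K.*-congˡ (RK.x+[y-x]≈y (f x′) (f x))) ⟩
          x K.+ γ K.* f x
            ≈⟨ eval-X+γTr γ x ⟨
          eval (X +ₚ γ ·ₚ Trₚ H) x ∎)
          where
          v = u F.* d⁻¹
          γ = α K.* ι v
          vd≈u : v F.* d F.≈ u
          vd≈u = F.trans (F.*-assoc u d⁻¹ d) (F.trans (F.*-congˡ d⁻¹d≈1) (F.*-identityʳ u))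
          ιuα≈γδ : ι u K.* α K.≈ γ K.* δ
          ιuα≈γδ = begin
            ι u K.* α               ≈⟨ K.*-comm (ι u) α ⟩
            α K.* ι u               ≈⟨ K.*-congˡ (⟦⟧-cong vd≈u) ⟨
            α K.* ι (v F.* d)       ≈⟨ K.*-congˡ (*-homo v d) ⟩
            α K.* (ι v K.* ι d)     ≈⟨ K.*-assoc α (ι v) (ι d) ⟨
            γ K.* ι d               ≈⟨ K.*-congˡ (ι-φ-difference x x′) ⟩
            γ K.* δ                 ∎

theorem2p4 : ∀ {a ℓ₁ ℓ₂ b ℓ₃ ℓ₄} (q n : ℕ) → IsPrimePower q → 1 ≤ n →
    (E : FiniteFieldExtension q n a ℓ₁ ℓ₂ b ℓ₃ ℓ₄) →
    let open Extension E in
    (H : Poly) → ¬ IsConstant (λ x → Tr (eval H x)) →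
    (α : K.Carrier) → ¬ α K.≈ K.0# →
    ((α 𝔽q) ⊆ P H) ⇔ IsLinearTranslator (λ x → Tr (eval H x)) F.0# α
theorem2p4 q n isPrimePower _ E H _ α α≉0 =
  mk⇔ (line⊆P⇒translator H α α≉0) (translator⇒line⊆P H α)
  where open TraceLemmas isPrimePower E
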